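{- (1) Let $(W,\le,P,Q)$ be a $PQ$-frame such that for all $x,y,z\in W$: ($x\le y$ and $xPz$ imply $xQy$) and ($x\le y$ and $xQz$ imply $xPy$). If we define $$xRyz\iff (xPy\text{ and }x\le z)\text{ or }(x\le y\text{ and }xQz),$$ then $(W,\le,R)$ is a Birkhoff frame, and $P,Q$ are obtained from $R$ via $xPy\iff\exists w(xRyw)$ and $xQy\iff\exists w(xRwy)$. (2) Let $(W,\le,R)$ be a Birkhoff frame that satisfies, for all $x,y,z\in W$, $$xRyz\iff(\exists w(xRyw)\text{ and }x\le z)\text{ or }(x\le y\text{ and }\exists w(xRwz)),$$ and define $xPy\iff\exists w(xRyw)$ and $xQy\iff\exists w(xRwy)$. Then $(W,\le,P,Q)$ is a $PQ$-frame in which, for all $x,y,z\in W$, ($x\le y$ and $xPz$ imply $xQy$) and ($x\le y$ and $xQz$ imply $xPy$) hold.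
   Context: A $PQ$-frame is a structure $(W,\le,P,Q)$ where $(W,\le)$ is a poset and $P,Q\subseteq W^2$ are weakening relations, i.e., $u\le x$, $xPy$, $y\le v$ imply $uPv$, and $u\le x$, $xQy$, $y\le v$ imply $uQv$. A Birkhoff frame is a triple $(W,\le,R)$ where $(W,\le)$ is a poset and $R\subseteq W^3$ (written $xRyz$ for $(x,y,z)\in R$) satisfies: (R1) $u\le x$ and $xRyz$ imply $uRyz$; (R2) $xRyz$ and $y\le v$ imply $xRvz$; (R3) $xRyz$ and $z\le w$ imply $xRyw$. -}

module Defs where

open import Level using (Level; _⊔_; suc)
open import Data.Product using (_×_; ∃-syntax)
open import Data.Sum using (_⊎_)
open import Relation.Binary.Core using (Rel)
open import Relation.Binary.Bundles using (Poset)

private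
  variable
    a c ℓ₁ ℓ₂ p q r : Level

Rel₃ : Set a → (ℓ : Level) → Set (a ⊔ suc ℓ)
Rel₃ A ℓ = A → A → A → Set ℓ

module _ (W : Poset c ℓ₁ ℓ₂) where
  open Poset W using (Carrier; _≤_)

  -- Antisymmetry in a Poset is up to its equivalence _≈_. By reflexivity of
  -- _≤_ over _≈_, the closure conditions below already force the relations
  -- to respect _≈_, so no separate congruence axiom is needed.

  IsWeakening : Rel Carrier p → Set (c ⊔ ℓ₂ ⊔ p)
  IsWeakening P = ∀ {u x y v} → u ≤ x → P x y → y ≤ v → P u v

  record IsPQFrame (P : Rel Carrier p) (Q : Rel Carrier q)
                   : Set (c ⊔ ℓ₂ ⊔ p ⊔ q) where
    field
      P-weakening : IsWeakening P
      Q-weakening : IsWeakening Q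

  record IsBirkhoffFrame (R : Rel₃ Carrier r) : Set (c ⊔ ℓ₂ ⊔ r) where
    field
      R1 : ∀ {u x y z} → u ≤ x → R x y z → R u y z
      R2 : ∀ {x y z v} → R x y z → y ≤ v → R x v z
      R3 : ∀ {x y z w} → R x y z → z ≤ w → R x y w

  ternary : Rel Carrier p → Rel Carrier q → Rel₃ Carrier (ℓ₂ ⊔ p ⊔ q)
  ternary P Q x y z = (P x y × x ≤ z) ⊎ (x ≤ y × Q x z)

  PQCondition : Rel Carrier p → Rel Carrier q → Set (c ⊔ ℓ₂ ⊔ p ⊔ q)
  PQCondition P Q = ∀ x y z →
    (x ≤ y × P x z → Q x y) × (x ≤ y × Q x z → P x y)

binaryP : {A : Set a} → Rel₃ A r → Rel A (a ⊔ r)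
binaryP R x y = ∃[ w ] R x y w

binaryQ : {A : Set a} → Rel₃ A r → Rel A (a ⊔ r)
binaryQ R x y = ∃[ w ] R x w y

{-# OPTIONS --safe #-}
module Submission where

open import Level using (Level)
open import Data.Product using (_×_; _,_; proj₁; proj₂; map₂)
open import Data.Sum using (inj₁; inj₂)
open import Function.Bundles using (_⇔_; mk⇔; Equivalence)
open import Relation.Binary.Core using (Rel)
open import Relation.Binary.Bundles using (Poset)
open import Defs

-- Each disjunct of `ternary P Q` pairs one of the two relations with an order inequality, so
-- closure of `R` is inherited from weakening and transitivity. Projecting `R` back to `P` or `Q` is
-- easy on the matching disjunct, where reflexivity supplies the missing inequality; on the other
-- disjunct the recovery is precisely what `PQCondition` grants. Conversely, a premise of
-- `PQCondition` is itself a disjunct of `ternary`, hence yields a triple of `R` whose other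
-- projection is the conclusion.

private
  variable
    c ℓ₁ ℓ₂ p q r : Level

module _ (W : Poset c ℓ₁ ℓ₂) where
  open Poset W using (Carrier; _≤_; refl; trans)

  module _ {P : Rel Carrier p} {Q : Rel Carrier q} where

    ternary-isBirkhoffFrame : IsPQFrame W P Q → IsBirkhoffFrame W (ternary W P Q)
    ternary-isBirkhoffFrame F = record
      { R1 = λ { u≤x (inj₁ (xPy , x≤z)) → inj₁ (P-weakening u≤x xPy refl , trans u≤x x≤z)
               ; u≤x (inj₂ (x≤y , xQz)) → inj₂ (trans u≤x x≤y , Q-weakening u≤x xQz refl) }
      ; R2 = λ { (inj₁ (xPy , x≤z)) y≤v → inj₁ (P-weakening refl xPy y≤v , x≤z)
               ; (inj₂ (x≤y , xQz)) y≤v → inj₂ (trans x≤y y≤v , xQz) }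
      ; R3 = λ { (inj₁ (xPy , x≤z)) z≤w → inj₁ (xPy , trans x≤z z≤w)
               ; (inj₂ (x≤y , xQz)) z≤w → inj₂ (x≤y , Q-weakening refl xQz z≤w) }
      }
      where open IsPQFrame F

    P⇔binaryP-ternary : PQCondition W P Q → ∀ x y → P x y ⇔ binaryP (ternary W P Q) x y
    P⇔binaryP-ternary cond x y = mk⇔
      (λ xPy → x , inj₁ (xPy , refl))
      λ { (_ , inj₁ (xPy , _)) → xPy
        -- The mismatched disjunct: only `Q` is known here, and the condition turns it into `P` at
        -- `y`.
        ; (w , inj₂ x≤y,xQw)   → proj₂ (cond x y w) x≤y,xQw }

    Q⇔binaryQ-ternary : PQCondition W P Q → ∀ x y → Q x y ⇔ binaryQ (ternary W P Q) x y
    Q⇔binaryQ-ternary cond x y = mk⇔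
      (λ xQy → x , inj₂ (refl , xQy))
      λ { (w , inj₁ (xPw , x≤y)) → proj₁ (cond x y w) (x≤y , xPw)
        ; (_ , inj₂ (_ , xQy))   → xQy }

  module _ {R : Rel₃ Carrier r} where

    -- The existential witness never changes: `R1` with `R2`, or `R1` with `R3`, move only the two
    -- visible coordinates.
    binary-isPQFrame : IsBirkhoffFrame W R → IsPQFrame W (binaryP R) (binaryQ R)
    binary-isPQFrame F = record
      { P-weakening = λ u≤x xPy y≤v → map₂ (λ xRyw → R2 (R1 u≤x xRyw) y≤v) xPy
      ; Q-weakening = λ u≤x xQy y≤v → map₂ (λ xRwy → R3 (R1 u≤x xRwy) y≤v) xQy
      }
      where open IsBirkhoffFrame F

    binary-PQCondition :
      (∀ x y z → ternary W (binaryP R) (binaryQ R) x y z → R x y z) →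
      PQCondition W (binaryP R) (binaryQ R)
    binary-PQCondition ternary⇒R x y z =
        -- The triple is taken with `y` and `z` exchanged, so that `z` lands in the middle slot,
        -- which `binaryQ` quantifies away.
        (λ (x≤y , xPz) → z , ternary⇒R x z y (inj₁ (xPz , x≤y)))
      , (λ x≤y,xQz → z , ternary⇒R x y z (inj₂ x≤y,xQz))

theorem4p5 : (c ℓ₁ ℓ₂ p q r : Level) →
    ((W : Poset c ℓ₁ ℓ₂) (P : Rel (Poset.Carrier W) p) (Q : Rel (Poset.Carrier W) q) →
    IsPQFrame W P Q →
    PQCondition W P Q →
    IsBirkhoffFrame W (ternary W P Q)
    × (∀ x y → P x y ⇔ binaryP (ternary W P Q) x y)
    × (∀ x y → Q x y ⇔ binaryQ (ternary W P Q) x y))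
    ×
    ((W : Poset c ℓ₁ ℓ₂) (R : Rel₃ (Poset.Carrier W) r) →
    IsBirkhoffFrame W R →
    (∀ x y z → R x y z ⇔ ternary W (binaryP R) (binaryQ R) x y z) →
    IsPQFrame W (binaryP R) (binaryQ R)
    × PQCondition W (binaryP R) (binaryQ R))
theorem4p5 _ _ _ _ _ _ =
    (λ W P Q frame cond →
        ternary-isBirkhoffFrame W frame
      , P⇔binaryP-ternary W cond
      , Q⇔binaryQ-ternary W cond)
  , (λ W R frame R⇔ternary →
        binary-isPQFrame W frame
      , binary-PQCondition W (λ x y z → Equivalence.from (R⇔ternary x y z)))
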